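{- Assume that for every tall Borel $\mathscr S$-Ramsey ideal $\mathcal I$ on $\omega$ there are $X\in\mathcal I^+$ and a closed hereditary tall family $\mathcal K\subseteq\mathcal I$ with $\{H\subseteq X:\mathscr S\upharpoonright H\subseteq\mathcal K,\ H\text{ infinite}\}\subseteq\mathcal I$. Then there is no tall Borel $\mathscr S$-Ramsey ideal on $\omega$, and hence there is no tall Borel Nash--Williams ideal on $\omega$.
   Context: All ideals on $\omega$ are proper and contain all finite sets; they are viewed as subsets of $2^\omega\cong\mathcal P(\omega)$, so "Borel" and "closed" make sense. $\mathcal I^+=\mathcal P(\omega)\setminus\mathcal I$. An ideal or family of subsets of $\omega$ is tall if every infinite subset of $\omega$ has an infinite subset in it; a family is hereditary if closed under subsets. For infinite $M\subseteq\omega$, a barrier on $M$ is a family $\mathcal B$ of nonempty finite subsets of $M$ such that every infinite subset of $M$ has an initial segment in $\mathcal B$ and no member of $\mathcal B$ is a proper subset of another. $\mathcal B\upharpoonright X=\{s\in\mathcal B:s\subseteq X\}$. For a barrier $\mathcal B$ on $M$, $\mathcal I$ is $\mathcal B$-Ramsey if for every $X\in\mathcal I^+$ with $X\subseteq M$ and every colouring of $\mathcal B\upharpoonright X$ with finitely many colours there is $H\subseteq X$, $H\in\mathcal I^+$, such that the colouring is constant on $\mathcal B\upharpoonright H$. $\mathcal I$ is Nash--Williams if it is $\mathcal B$-Ramsey for every barrier $\mathcal B$. The Schreier barrier is $\mathscr S=\{s\in[\omega]^{<\omega}\setminus\{\emptyset\}:|s|=\min(s)+1\}$, a barrier on $\omega$.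 -}

module Defs where

open import Level using (0ℓ) renaming (suc to lsuc)
open import Data.Bool using (Bool; true; T; _∨_)
open import Data.Nat using (ℕ; suc; _≤_; _<_)
open import Data.Fin using (Fin)
open import Data.Product using (∃; ∃-syntax; _×_)
open import Function.Bundles using (_↔_)
open import Relation.Nullary using (¬_)
open import Relation.Unary using (Pred; _∈_; _∉_; _⊆_; _⊂_; _≐_; ∁; ⋃; Satisfiable)
open import Relation.Binary.Definitions using (_Respects_)
open import Relation.Binary.PropositionalEquality using (_≡_; _≗_)

-- Subsets of ω are points of the Cantor space 2^ω.  Two of them are the same
-- set when they are pointwise equal (_≗_); as function extensionality is not
-- available, this is required explicitly wherever it matters.
𝒫ω : Set
𝒫ω = ℕ → Bool

⟦_⟧ : 𝒫ω → Pred ℕ 0ℓ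
⟦ A ⟧ n = T (A n)

ω : 𝒫ω
ω _ = true

_∪_ : 𝒫ω → 𝒫ω → 𝒫ω
(A ∪ B) n = A n ∨ B n

Family : Set₁
Family = Pred 𝒫ω 0ℓ

HasSize : 𝒫ω → ℕ → Set
HasSize A k = Fin k ↔ ∃ ⟦ A ⟧

Finite : Pred 𝒫ω 0ℓ
Finite A = ∃[ k ] HasSize A k

Infinite : Pred 𝒫ω 0ℓ
Infinite A = ¬ Finite A

-- The product topology: the sets { B : B agrees with A below n } are a
-- neighbourhood base at A.
IsOpen : Family → Set
IsOpen U = ∀ A → A ∈ U → ∃[ n ] (∀ B → (∀ i → i < n → A i ≡ B i) → B ∈ U)

IsClosed : Family → Set
IsClosed F = IsOpen (∁ F)

-- The σ-algebra generated by the open sets; `resp` identifies families with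
-- the same members.
data Borel : Pred Family (lsuc 0ℓ) where
  isOpen : ∀ {U} → IsOpen U → Borel U
  compl  : ∀ {F} → Borel F → Borel (∁ F)
  union  : ∀ {F : ℕ → Family} → (∀ n → Borel (F n)) → Borel (⋃ ℕ F)
  resp   : ∀ {F G} → F ≐ G → Borel F → Borel G

Hereditary : Family → Set
Hereditary F = ∀ {A B} → ⟦ A ⟧ ⊆ ⟦ B ⟧ → B ∈ F → A ∈ F

Tall : Family → Set
Tall F = ∀ A → Infinite A → ∃[ B ] (⟦ B ⟧ ⊆ ⟦ A ⟧ × Infinite B × B ∈ F)

record IsIdeal (I : Family) : Set where
  field
    hereditary     : Hereditary I
    ∪-closed       : ∀ {A B} → A ∈ I → B ∈ I → (A ∪ B) ∈ I
    containsFinite : Finite ⊆ I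
    proper         : ω ∉ I

_⁺ : Family → Family
I ⁺ = ∁ I

InitialSegment : 𝒫ω → 𝒫ω → Set
InitialSegment s X =
  ⟦ s ⟧ ⊆ ⟦ X ⟧ × (∀ {i j} → i ∈ ⟦ X ⟧ → j ∈ ⟦ s ⟧ → i ≤ j → i ∈ ⟦ s ⟧)

record IsBarrier (M : 𝒫ω) (ℬ : Family) : Set where
  field
    respects  : ℬ Respects _≗_
    finite    : ℬ ⊆ Finite
    nonempty  : ∀ {s} → s ∈ ℬ → Satisfiable ⟦ s ⟧
    within    : ∀ {s} → s ∈ ℬ → ⟦ s ⟧ ⊆ ⟦ M ⟧
    covers    : ∀ X → ⟦ X ⟧ ⊆ ⟦ M ⟧ → Infinite X → ∃[ s ] (s ∈ ℬ × InitialSegment s X)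
    antichain : ∀ {s t} → s ∈ ℬ → t ∈ ℬ → ¬ (⟦ s ⟧ ⊂ ⟦ t ⟧)

infix 7 _↾_
_↾_ : Family → 𝒫ω → Family
(ℬ ↾ X) s = s ∈ ℬ × ⟦ s ⟧ ⊆ ⟦ X ⟧

record Colouring (F : Family) (k : ℕ) : Set where
  field
    colour : ∀ s → s ∈ F → Fin k
    -- The colour depends only on the set s: neither on its representation nor
    -- on the membership proof.
    colour-cong : ∀ {s t} (p : s ∈ F) (q : t ∈ F) → s ≗ t → colour s p ≡ colour t q

ConstantOn : ∀ {F k} → Colouring F k → Family → Set
ConstantOn {F} c G =
  ∀ s t (p : s ∈ F) (q : t ∈ F) → s ∈ G → t ∈ G → colour s p ≡ colour t q
  where open Colouring c

-- For a barrier ℬ on M, the ideal I is ℬ-Ramsey.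
Ramsey : 𝒫ω → Family → Family → Set
Ramsey M ℬ I =
  ∀ X → X ∈ I ⁺ → ⟦ X ⟧ ⊆ ⟦ M ⟧ → ∀ k (c : Colouring (ℬ ↾ X) k) →
  ∃[ H ] (⟦ H ⟧ ⊆ ⟦ X ⟧ × H ∈ I ⁺ × ConstantOn c (ℬ ↾ H))

NashWilliams : Family → Set₁
NashWilliams I = ∀ M → Infinite M → ∀ ℬ → IsBarrier M ℬ → Ramsey M ℬ I

IsMin : ℕ → 𝒫ω → Set
IsMin m s = m ∈ ⟦ s ⟧ × (∀ {n} → n ∈ ⟦ s ⟧ → m ≤ n)

𝒮 : Family
𝒮 s = ∃[ m ] (IsMin m s × HasSize s (suc m))

{-# OPTIONS --safe #-}
module Submission where

-- Colour a Schreier set s ⊆ X according to whether s ∈ K.  A homogeneous H ∈ I⁺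
-- contains an infinite B ∈ K by tallness, and the initial segment of B in 𝒮 is
-- in K by heredity; hence every Schreier subset of H is in K, which forces
-- H ∈ I.  The Nash–Williams part follows because 𝒮 is a barrier on ω.

open import Defs
open import Level using (0ℓ)
open import Axiom.ExcludedMiddle using (ExcludedMiddle)
open import Data.Bool using (_∧_)
open import Data.Bool.Properties using (T?; T-∧; T-irrelevant)
open import Data.Fin using (Fin; zero; suc)
open import Data.Fin.Properties using (injective⇒≤)
open import Data.Nat using (ℕ; zero; suc; _≤_; _<_; s≤s; _<ᵇ_; _≟_; _<?_)
open import Data.Nat.Induction using (<-rec)
open import Data.Nat.Properties
  using (anyUpTo?; ≮⇒≥; ≤-pred; ≤-antisym; ≤-trans; ≤-<-trans; <-≤-trans; n≮n; n<1+n; m<n⇒m<1+n; <⇒<ᵇ; <ᵇ⇒<)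
open import Data.Product using (_×_; ∃-syntax; ∃; _,_; proj₁; proj₂; map₂; -,_)
open import Data.Unit using (tt)
open import Function using (_∘_)
open import Function.Bundles using (mk↔ₛ′; Inverse; Equivalence)
open import Relation.Binary.PropositionalEquality
  using (_≡_; _≢_; _≗_; refl; sym; trans; cong; subst)
open import Relation.Nullary using (¬_; Dec; yes; no; contradiction)
open import Relation.Nullary.Decidable using (decidable-stable)
open import Relation.Unary using (Pred; _∈_; _∉_; _⊆_; Satisfiable; Decidable)

-- Sizes of subsets of ω.

⟦⟧-≡ : ∀ {A : 𝒫ω} {x y : ∃ ⟦ A ⟧} → proj₁ x ≡ proj₁ y → x ≡ y
⟦⟧-≡ {x = m , p} {y = .m , q} refl = cong (m ,_) (T-irrelevant p q)

≗⇒⊆ : ∀ {A B : 𝒫ω} → A ≗ B → ⟦ A ⟧ ⊆ ⟦ B ⟧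
≗⇒⊆ A≗B {n} = subst (λ b → ⟦ (λ _ → b) ⟧ n) (A≗B n)

HasSize-resp : ∀ {A B k} → ⟦ A ⟧ ⊆ ⟦ B ⟧ → ⟦ B ⟧ ⊆ ⟦ A ⟧ → HasSize A k → HasSize B k
HasSize-resp A⊆B B⊆A h = mk↔ₛ′
  (map₂ A⊆B ∘ to) (from ∘ map₂ B⊆A)
  (λ y → ⟦⟧-≡ (cong proj₁ (strictlyInverseˡ (map₂ B⊆A y))))
  (λ i → trans (cong from (⟦⟧-≡ refl)) (strictlyInverseʳ i))
  where open Inverse h

HasSize-insert : ∀ {A B j k} → j ∉ ⟦ A ⟧ → j ∈ ⟦ B ⟧ → ⟦ A ⟧ ⊆ ⟦ B ⟧ →
  (∀ {n} → n ∈ ⟦ B ⟧ → n ≢ j → n ∈ ⟦ A ⟧) → HasSize A k → HasSize B (suc k)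
HasSize-insert {A} {B} {j} {k} j∉A j∈B A⊆B B∖j⊆A h = mk↔ₛ′ to′ from′ to∘from from∘to
  where
  open Inverse h

  to′ : Fin (suc k) → ∃ ⟦ B ⟧
  to′ zero    = j , j∈B
  to′ (suc i) = map₂ A⊆B (to i)

  from′ : ∃ ⟦ B ⟧ → Fin (suc k)
  from′ (n , n∈B) with n ≟ j
  ... | yes _  = zero
  ... | no n≢j = suc (from (n , B∖j⊆A n∈B n≢j))

  to∘from : ∀ y → to′ (from′ y) ≡ y
  to∘from (n , n∈B) with n ≟ j
  ... | yes n≡j = ⟦⟧-≡ (sym n≡j)
  ... | no n≢j  = ⟦⟧-≡ (cong proj₁ (strictlyInverseˡ (n , B∖j⊆A n∈B n≢j)))

  from∘to : ∀ i → from′ (to′ i) ≡ i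
  from∘to zero with j ≟ j
  ... | yes _  = refl
  ... | no j≢j = contradiction refl j≢j
  from∘to (suc i) with proj₁ (to i) ≟ j
  -- An element enumerated from `A` cannot be the new point `j`.
  ... | yes e = contradiction (subst (_∈ ⟦ A ⟧) e (proj₂ (to i))) j∉A
  ... | no _  = cong suc (trans (cong from (⟦⟧-≡ refl)) (strictlyInverseʳ i))

-- Pigeonhole: `a < b` unfolds to `suc a ≤ b`, so it suffices to inject `Fin (suc a)` into `B`, the
-- extra index going to `j` and the others enumerating `A`.
HasSize-< : ∀ {A B j a b} → HasSize A a → HasSize B b →
  ⟦ A ⟧ ⊆ ⟦ B ⟧ → j ∈ ⟦ B ⟧ → j ∉ ⟦ A ⟧ → a < b
HasSize-< {A} {B} {j} {a} {b} hA hB A⊆B j∈B j∉A =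
  injective⇒≤ (λ {x} {y} → f-injective x y ∘ from-injective)
  where
  module A = Inverse hA
  module B = Inverse hB

  f : Fin (suc a) → ∃ ⟦ B ⟧
  f zero    = j , j∈B
  f (suc i) = map₂ A⊆B (A.to i)

  from-injective : ∀ {x y} → B.from x ≡ B.from y → x ≡ y
  from-injective {x} {y} e =
    trans (sym (B.strictlyInverseˡ x)) (trans (cong B.to e) (B.strictlyInverseˡ y))

  j∉to : ∀ i → j ≢ proj₁ (A.to i)
  j∉to i e = j∉A (subst (_∈ ⟦ A ⟧) (sym e) (proj₂ (A.to i)))

  f-injective : ∀ x y → f x ≡ f y → x ≡ y
  f-injective zero    zero    _ = refl
  f-injective zero    (suc i) e = contradiction (cong proj₁ e) (j∉to i)
  f-injective (suc i) zero    e = contradiction (sym (cong proj₁ e)) (j∉to i)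
  f-injective (suc i) (suc l) e = cong suc
    (trans (sym (A.strictlyInverseʳ i))
    (trans (cong A.from (⟦⟧-≡ (cong proj₁ e))) (A.strictlyInverseʳ l)))

least : ∀ {P : Pred ℕ 0ℓ} → Decidable P → Satisfiable P →
  ∃[ m ] (P m × (∀ {n} → P n → m ≤ n))
least {P} P? (n , n∈P) = <-rec _ step n n∈P
  where
  step : ∀ n → (∀ {l} → l < n → P l → ∃[ m ] (P m × (∀ {i} → P i → m ≤ i))) →
    P n → ∃[ m ] (P m × (∀ {i} → P i → m ≤ i))
  step n rec n∈P with anyUpTo? P? n
  ... | yes (_ , l<n , l∈P) = rec l<n l∈P
  ... | no none = n , n∈P , λ {i} i∈P → ≮⇒≥ λ i<n → none (i , i<n , i∈P)

-- Truncations as initial segments.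

below : ℕ → 𝒫ω → 𝒫ω
below n X i = X i ∧ (i <ᵇ n)

∈-below⁺ : ∀ n X {i} → i ∈ ⟦ X ⟧ → i < n → i ∈ ⟦ below n X ⟧
∈-below⁺ _ _ i∈X i<n = Equivalence.from T-∧ (i∈X , <⇒<ᵇ i<n)

∈-below⁻ : ∀ n X {i} → i ∈ ⟦ below n X ⟧ → i ∈ ⟦ X ⟧ × i < n
∈-below⁻ n X {i} = map₂ (<ᵇ⇒< i n) ∘ Equivalence.to (T-∧ {X i})

below⊆ : ∀ n X → ⟦ below n X ⟧ ⊆ ⟦ X ⟧
below⊆ n X = proj₁ ∘ ∈-below⁻ n X

below-initial : ∀ n X → InitialSegment (below n X) X
below-initial n X = below⊆ n X ,
  λ i∈X j∈s i≤j → ∈-below⁺ n X i∈X (≤-<-trans i≤j (proj₂ (∈-below⁻ n X j∈s)))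

-- The minimum `m` survives truncation: size `suc m` provides some element, which is at least `m`
-- and below `n`.
below∈𝒮 : ∀ n X {m} → IsMin m X → HasSize (below n X) (suc m) → below n X ∈ 𝒮
below∈𝒮 n X {m} (m∈X , m-least) h =
  m , (∈-below⁺ n X m∈X (≤-<-trans (m-least (proj₁ first∈below)) (proj₂ first∈below)) , m-least ∘ below⊆ n X) , h
  where
  first∈below : proj₁ (Inverse.to h zero) ∈ ⟦ X ⟧ × proj₁ (Inverse.to h zero) < n
  first∈below = ∈-below⁻ n X (proj₂ (Inverse.to h zero))

-- Infinite sets and the Schreier barrier.

module _ (em : ExcludedMiddle 0ℓ) where

  -- Otherwise `X` would coincide with its finite truncation at `n`.
  unbounded : ∀ n {X k} → Infinite X → HasSize (below n X) k → ∃[ j ] (j ∈ ⟦ X ⟧ × n ≤ j)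
  unbounded n {X} X-inf h = decidable-stable em λ bounded → X-inf
    (-, HasSize-resp (below⊆ n X)
      (λ {i} i∈X → ∈-below⁺ n X i∈X
        (decidable-stable (i <? n) λ i≮n → bounded (i , i∈X , ≮⇒≥ i≮n))) h)

  below-size : ∀ {X} → Infinite X → ∀ k → ∃[ n ] HasSize (below n X) k
  below-size {X} X-inf zero = 0 , mk↔ₛ′ (λ ()) empty (λ x → contradiction (empty x) λ ()) (λ ())
    where
    empty : ∃ ⟦ below 0 X ⟧ → Fin 0
    empty (_ , p) with () ← proj₂ (∈-below⁻ 0 X p)
  below-size {X} X-inf (suc k)
    with n , h ← below-size X-inf k
    -- Taking the least element of `X` from `n` on makes the cut at `suc j` gain exactly one point.
    with j , (j∈X , n≤j) , j-least ← least (λ _ → em) (unbounded n X-inf h)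
    = suc j , HasSize-insert j∉below (∈-below⁺ (suc j) X j∈X (n<1+n j)) below-mono others h
    where
    j∉below : j ∉ ⟦ below n X ⟧
    j∉below p = n≮n j (<-≤-trans (proj₂ (∈-below⁻ n X p)) n≤j)

    below-mono : ⟦ below n X ⟧ ⊆ ⟦ below (suc j) X ⟧
    below-mono p with i∈X , i<n ← ∈-below⁻ n X p =
      ∈-below⁺ (suc j) X i∈X (m<n⇒m<1+n (<-≤-trans i<n n≤j))

    others : ∀ {i} → i ∈ ⟦ below (suc j) X ⟧ → i ≢ j → i ∈ ⟦ below n X ⟧
    others {i} p i≢j with i∈X , i<1+j ← ∈-below⁻ (suc j) X p =
      ∈-below⁺ n X i∈X (decidable-stable (i <? n) λ i≮n →
        i≢j (≤-antisym (≤-pred i<1+j) (j-least (i∈X , ≮⇒≥ i≮n))))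

  infinite⇒min : ∀ {X} → Infinite X → ∃[ m ] IsMin m X
  infinite⇒min {X} X-inf = least (λ i → T? (X i))
    -- The cut of size 0 is made at 0, so `unbounded` yields an arbitrary element from which to
    -- search for the least one.
    (let n , h = below-size X-inf 0 in map₂ proj₁ (unbounded n X-inf h))

  𝒮-covers : ∀ X → Infinite X → ∃[ s ] (s ∈ 𝒮 × InitialSegment s X)
  𝒮-covers X X-inf =
    let m , m-min = infinite⇒min X-inf
        n , h     = below-size X-inf (suc m)
    in below n X , below∈𝒮 n X m-min h , below-initial n X

  𝒮-isBarrier : IsBarrier ω 𝒮
  𝒮-isBarrier = record
    { respects  = λ s≗t (m , (m∈s , m-least) , h) →
        m , (≗⇒⊆ s≗t m∈s , m-least ∘ ≗⇒⊆ (sym ∘ s≗t)) , HasSize-resp (≗⇒⊆ s≗t) (≗⇒⊆ (sym ∘ s≗t)) h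
    ; finite    = λ (_ , _ , h) → -, h
    ; nonempty  = λ (m , (m∈s , _) , _) → m , m∈s
    ; within    = λ _ _ → tt
    ; covers    = λ X _ → 𝒮-covers X
    -- A proper inclusion of `s` in `t` would force min s + 1 < min t + 1, yet the larger set has
    -- the smaller or equal minimum.
    ; antichain = λ {s} (m , (m∈s , _) , hs) (_ , (_ , l-least) , ht) (s⊆t , t⊈s) →
        t⊈s λ {x} x∈t → decidable-stable (T? (s x)) λ x∉s →
          n≮n _ (≤-trans (HasSize-< hs ht s⊆t x∈t x∉s) (s≤s (l-least (s⊆t m∈s))))
    }

  -- Colouring by membership in a hereditary family.

  indicator : ∀ {K} → Hereditary K → ∀ F → Colouring F 2
  indicator {K} K-her F = record
    { colour      = λ s _ → side (em {K s})
    -- Heredity makes membership in `K` invariant under pointwise equality.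
    ; colour-cong = λ {s} {t} _ _ s≗t → side-cong (K-her (≗⇒⊆ (sym ∘ s≗t))) (K-her (≗⇒⊆ s≗t)) em em
    }
    where
    side : ∀ {P : Set} → Dec P → Fin 2
    side (yes _) = zero
    side (no _)  = suc zero

    side-cong : ∀ {P Q : Set} → (P → Q) → (Q → P) → (p? : Dec P) (q? : Dec Q) → side p? ≡ side q?
    side-cong f g (yes _) (yes _) = refl
    side-cong f g (yes p) (no ¬q) = contradiction (f p) ¬q
    side-cong f g (no ¬p) (yes q) = contradiction (g q) ¬p
    side-cong f g (no _)  (no _)  = refl

  indicator-reflects : ∀ {K s t} (K-her : Hereditary K) F (p : s ∈ F) (q : t ∈ F) →
    let open Colouring (indicator {K} K-her F) in
    colour s p ≡ colour t q → s ∈ K → t ∈ K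
  indicator-reflects {K} {s} {t} _ _ _ _ e s∈K with em {K s} | em {K t}
  ... | _       | yes t∈K = t∈K
  ... | no s∉K  | no _    = contradiction s∈K s∉K
  ... | yes _   | no _    with () ← e

  -- The Schreier set found here determines which of the two colours a homogeneous `H` carries.
  infinite⇒𝒮∩K : ∀ {K} → Hereditary K → Tall K → ∀ {H} → Infinite H →
    ∃[ s ] (s ∈ K × (𝒮 ↾ H) s)
  infinite⇒𝒮∩K K-her K-tall {H} H-inf =
    let B , B⊆H , B-inf , B∈K = K-tall H H-inf
        s , s∈𝒮 , s⊆B , _ = 𝒮-covers B B-inf
    in s , K-her s⊆B B∈K , s∈𝒮 , B⊆H ∘ s⊆B

  𝒮-Ramsey⇒positive : ∀ {I} → IsIdeal I → Ramsey ω 𝒮 I →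
    ∀ {X K} → X ∈ I ⁺ → Hereditary K → Tall K →
    ∃[ H ] (H ∈ I ⁺ × ⟦ H ⟧ ⊆ ⟦ X ⟧ × (𝒮 ↾ H) ⊆ K × Infinite H)
  𝒮-Ramsey⇒positive ideal ramsey {X} {K} X∈I⁺ K-her K-tall =
    let H , H⊆X , H∈I⁺ , constant = ramsey X X∈I⁺ _ 2 (indicator K-her (𝒮 ↾ X))
        -- A positive set is infinite because the ideal contains all finite sets.
        H-inf = H∈I⁺ ∘ IsIdeal.containsFinite ideal
        s , s∈K , s∈𝒮 , s⊆H = infinite⇒𝒮∩K K-her K-tall H-inf
    in H , H∈I⁺ , H⊆X
    , (λ {t} (t∈𝒮 , t⊆H) →
        let p : (𝒮 ↾ X) s
            p = s∈𝒮 , H⊆X ∘ s⊆H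
            q : (𝒮 ↾ X) t
            q = t∈𝒮 , H⊆X ∘ t⊆H
        -- Constancy on `𝒮 ↾ H` carries membership in `K` from the one known `s` to every `t`; `p`
        -- and `q` place both in the domain of the colouring, which lives over `X`.
        in indicator-reflects K-her (𝒮 ↾ X) p q (constant s t p q (s∈𝒮 , s⊆H) (t∈𝒮 , t⊆H)) s∈K)
    , H-inf

nashWilliams⇒𝒮-Ramsey : ExcludedMiddle 0ℓ → ∀ {I} → IsIdeal I → NashWilliams I → Ramsey ω 𝒮 I
nashWilliams⇒𝒮-Ramsey em ideal nw =
  -- If ω were finite it would belong to the ideal, against properness.
  nw ω (IsIdeal.proper ideal ∘ IsIdeal.containsFinite ideal) 𝒮 (𝒮-isBarrier em)

proposition8p10 : ExcludedMiddle 0ℓ →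
    (∀ (I : Family) → IsIdeal I → Tall I → Borel I → Ramsey ω 𝒮 I →
    ∃[ X ] ∃[ K ] (X ∈ I ⁺ × IsClosed K × Hereditary K × Tall K × K ⊆ I ×
    (λ (H : 𝒫ω) → ⟦ H ⟧ ⊆ ⟦ X ⟧ × (𝒮 ↾ H) ⊆ K × Infinite H) ⊆ I)) →
    (¬ (∃[ I ] (IsIdeal I × Tall I × Borel I × Ramsey ω 𝒮 I))) ×
    (¬ (∃[ I ] (IsIdeal I × Tall I × Borel I × NashWilliams I)))
proposition8p10 em hyp = noRamsey ,
  λ (I , ideal , tall , borel , nw) →
    noRamsey (I , ideal , tall , borel , nashWilliams⇒𝒮-Ramsey em ideal nw)
  where
  noRamsey : ¬ (∃[ I ] (IsIdeal I × Tall I × Borel I × Ramsey ω 𝒮 I))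
  noRamsey (I , ideal , tall , borel , ramsey) =
    let X , K , X∈I⁺ , _ , K-her , K-tall , _ , captures = hyp I ideal tall borel ramsey
        H , H∈I⁺ , H-props = 𝒮-Ramsey⇒positive em ideal ramsey {X} {K} X∈I⁺ K-her K-tall
    -- The assumption puts `H` in the ideal, while homogeneity was obtained with `H` positive.
    in H∈I⁺ (captures {H} H-props)
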